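{- Let $L$ be a language of algebras and $\mathfrak A$ an $L$-algebra with universe $A$. For all $a,d\in A$: $a:a\approx_{\mathfrak A}a:d$ holds if and only if $d=a$.
   Context: Let $L$ be a language of algebras: a set of function symbols, each with an arity in $\mathbb N$ (constants are 0-ary function symbols). Fix a countably infinite set $X$ of variables; $T_{L,X}$ is the set of $L$-terms over $X$, and $X(s)$ denotes the set of variables occurring in a term $s$. For an $L$-algebra $\mathfrak A$ with universe $A$, every term $s$ induces a function $s^{\mathfrak A}$, evaluated at assignments of elements of $A$ to variables. An arrow of $\mathfrak A$ is a pair $(a,b)\in A\times A$, written $a\to b$. The generalizations of an arrow $a\to b$ in $\mathfrak A$ are the pairs of arbitrary terms $s\to t$ with $s,t\in T_{L,X}$ such that there is an assignment $\sigma$ of elements of $A$ to the variables in $X(s)\cup X(t)$ with $s^{\mathfrak A}(\sigma)=a$ and $t^{\mathfrak A}(\sigma)=b$; their set is denoted $\uparrow_{\mathfrak A}(a\to b)$. For $L$-algebras $\mathfrak A,\mathfrak B$, an arrow $a\to b$ of $\mathfrak A$ and an arrow $c\to d$ of $\mathfrak B$, set $(a\to b)\uparrow_{(\mathfrak A,\mathfrak B)}(c\to d):=\uparrow_{\mathfrak A}(a\to b)\cap\uparrow_{\mathfrak B}(c\to d)$. A pair of terms $s\to t$ is trivial in $(\mathfrak A,\mathfrak B)$ if it belongs to $\uparrow_{\mathfrak A}(e)$ for every arrow $e$ of $\mathfrak A$ and to $\uparrow_{\mathfrak B}(e')$ for every arrow $e'$ of $\mathfrak B$. We write $a\to b\lesssim_{(\mathfrak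 A,\mathfrak B)}c\to d$ iff either (i) every element of $\uparrow_{\mathfrak A}(a\to b)\cup\uparrow_{\mathfrak B}(c\to d)$ is trivial in $(\mathfrak A,\mathfrak B)$, or (ii) $(a\to b)\uparrow_{(\mathfrak A,\mathfrak B)}(c\to d)$ contains an element not trivial in $(\mathfrak A,\mathfrak B)$ and, for every arrow $c'\to d'$ of $\mathfrak B$, the inclusion $(a\to b)\uparrow_{(\mathfrak A,\mathfrak B)}(c\to d)\subseteq(a\to b)\uparrow_{(\mathfrak A,\mathfrak B)}(c'\to d')$ implies equality of these two sets. Define $a\to b\approx_{(\mathfrak A,\mathfrak B)}c\to d$ iff $a\to b\lesssim_{(\mathfrak A,\mathfrak B)}c\to d$ and $c\to d\lesssim_{(\mathfrak B,\mathfrak A)}a\to b$. For $a,b\in A$ and $c,d\in B$, the similarity-based analogical proportion $a:b\approx_{(\mathfrak A,\mathfrak B)}c:d$ holds iff $a\to b\approx_{(\mathfrak A,\mathfrak B)}c\to d$ and $b\to a\approx_{(\mathfrak A,\mathfrak B)}d\to c$. We write $\approx_{\mathfrak A}$ for $\approx_{(\mathfrak A,\mathfrak A)}$. -}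

module Defs where

open import Level using (Level; _⊔_; suc)
open import Data.Nat.Base using (ℕ)
open import Data.Product.Base using (_×_; _,_; Σ-syntax; ∃-syntax)
open import Data.Sum.Base using (_⊎_; inj₁; inj₂)
open import Data.Vec.Base using (Vec; []; _∷_)
open import Data.Vec.Relation.Unary.Any using (Any; here; there)
open import Relation.Binary.PropositionalEquality.Core using (_≡_)
open import Relation.Nullary.Negation.Core using (¬_)
open import Relation.Unary using (Pred; _∈_; _⊆_; _≐_; _∩_; _∪_)

private
  variable
    o x p ℓ ℓ′ : Level

record Language (o : Level) : Set (suc o) where
  field
    Symbol : Set o
    arity  : Symbol → ℕ

open Language public

record Algebra (L : Language o) (ℓ : Level) : Set (o ⊔ suc ℓ) where
  field
    Carrier : Set ℓ
    op      : (f : Symbol L) → Vec Carrier (arity L f) → Carrier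

open Algebra public

data Term (L : Language o) (X : Set x) : Set (o ⊔ x) where
  var : X → Term L X
  app : (f : Symbol L) → Vec (Term L X) (arity L f) → Term L X

data Vars {L : Language o} {X : Set x} : Term L X → Pred X (o ⊔ x) where
  in-var : ∀ {v} → Vars (var v) v
  in-app : ∀ {f ts v} → Any (λ t → Vars t v) ts → Vars (app f ts) v

-- An assignment of elements of A to the members of the set of variables V.
-- Membership is an irrelevant argument, so that the value depends on the
-- variable only and not on which of its occurrences is looked at.
Assignment : {X : Set x} → Pred X p → Set ℓ → Set (x ⊔ p ⊔ ℓ)
Assignment V A = ∀ v → .(V v) → A

module _ {L : Language o} {X : Set x} (𝔄 : Algebra L ℓ) where

  eval  : (s : Term L X) → Assignment (Vars s) (Carrier 𝔄) → Carrier 𝔄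
  evals : ∀ {n} (ts : Vec (Term L X) n) →
          Assignment (λ v → Any (λ t → Vars t v) ts) (Carrier 𝔄) →
          Vec (Carrier 𝔄) n

  eval (var v)    σ = σ v in-var
  eval (app f ts) σ = op 𝔄 f (evals ts (λ v v∈ts → σ v (in-app v∈ts)))

  evals []       σ = []
  evals (t ∷ ts) σ = eval t (λ v v∈t → σ v (here v∈t))
                   ∷ evals ts (λ v v∈ts → σ v (there v∈ts))

infix 5 _⟶_
pattern _⟶_ s t = s , t

Arrow : {L : Language o} → Algebra L ℓ → Set ℓ
Arrow 𝔄 = Carrier 𝔄 × Carrier 𝔄

TermArrow : Language o → Set x → Set (o ⊔ x)
TermArrow L X = Term L X × Term L X

module _ {L : Language o} (X : Set x) where

  ↑ : (𝔄 : Algebra L ℓ) → Arrow 𝔄 → Pred (TermArrow L X) (o ⊔ x ⊔ ℓ)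
  ↑ 𝔄 (a ⟶ b) (s ⟶ t) =
    Σ[ σ ∈ Assignment (Vars s ∪ Vars t) (Carrier 𝔄) ]
      eval 𝔄 s (λ v v∈s → σ v (inj₁ v∈s)) ≡ a ×
      eval 𝔄 t (λ v v∈t → σ v (inj₂ v∈t)) ≡ b

  module _ (𝔄 : Algebra L ℓ) (𝔅 : Algebra L ℓ′) where

    ↑∩ : Arrow 𝔄 → Arrow 𝔅 → Pred (TermArrow L X) (o ⊔ x ⊔ ℓ ⊔ ℓ′)
    ↑∩ e e′ = ↑ 𝔄 e ∩ ↑ 𝔅 e′

    Trivial : Pred (TermArrow L X) (o ⊔ x ⊔ ℓ ⊔ ℓ′)
    Trivial g = (∀ e → g ∈ ↑ 𝔄 e) × (∀ e′ → g ∈ ↑ 𝔅 e′)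

    Similar≲ : Arrow 𝔄 → Arrow 𝔅 → Set (o ⊔ x ⊔ ℓ ⊔ ℓ′)
    Similar≲ e e′ =
        (↑ 𝔄 e ∪ ↑ 𝔅 e′ ⊆ Trivial)
      ⊎ ((∃[ g ] g ∈ ↑∩ e e′ × ¬ (g ∈ Trivial)) ×
         (∀ e″ → ↑∩ e e′ ⊆ ↑∩ e e″ → ↑∩ e e′ ≐ ↑∩ e e″))

  module _ (𝔄 : Algebra L ℓ) (𝔅 : Algebra L ℓ′) where

    Similar≈ : Arrow 𝔄 → Arrow 𝔅 → Set (o ⊔ x ⊔ ℓ ⊔ ℓ′)
    Similar≈ e e′ = Similar≲ 𝔄 𝔅 e e′ × Similar≲ 𝔅 𝔄 e′ e

    Proportion : (a b : Carrier 𝔄) (c d : Carrier 𝔅) → Set (o ⊔ x ⊔ ℓ ⊔ ℓ′)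
    Proportion a b c d =
      Similar≈ (a ⟶ b) (c ⟶ d) × Similar≈ (b ⟶ a) (d ⟶ c)

{-# OPTIONS --safe #-}
-- The pair x → x generalizes exactly the arrows e → e. If a → a ≲ a → d through
-- triviality, then x → x generalizes every arrow, in particular a → d. Otherwise
-- maximality, tested against the arrow a → a itself, gives ↑(a → a) ⊆ ↑(a → d),
-- so again x → x generalizes a → d. The converse is the reflexivity of ≲.
module Submission where

open import Defs
open import Level using (Level; _⊔_)
open import Axiom.ExcludedMiddle using (ExcludedMiddle)
open import Axiom.DoubleNegationElimination using (em⇒dne)
open import Data.Nat.Base using (ℕ)
open import Data.Product.Base using (_×_; _,_; ∃-syntax; proj₁; proj₂)
open import Data.Sum.Base using (inj₁; inj₂; [_,_]′)
open import Function.Base using (id)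
open import Function.Bundles using (_↔_; _⇔_; mk⇔; Inverse)
open import Relation.Binary.PropositionalEquality using (_≡_; refl; sym; trans)
open import Relation.Nullary.Decidable.Core using (yes; no)
open import Relation.Nullary.Negation.Core using (¬_)
open import Relation.Unary using (_∈_; _⊆_)

module _ {o x ℓ : Level} {X : Set x} {L : Language o} (𝔄 : Algebra L ℓ) where

  diagonal-generalizes-loop : ∀ v a → (var v ⟶ var v) ∈ ↑ X 𝔄 (a ⟶ a)
  diagonal-generalizes-loop v a = (λ _ _ → a) , refl , refl

  diagonal-generalizes⇒≡ : ∀ {v a b} → (var v ⟶ var v) ∈ ↑ X 𝔄 (a ⟶ b) → a ≡ b
  -- The two sides read the assignment at `v` under different membership proofs; these are
  -- irrelevant, so both values agree definitionally.
  diagonal-generalizes⇒≡ (_ , σv≡a , σv≡b) = trans (sym σv≡a) σv≡b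

  loop-≲⇒≡ : X → ∀ {a b c} → Similar≲ X 𝔄 𝔄 (a ⟶ a) (b ⟶ c) → b ≡ c
  loop-≲⇒≡ v {a} {b} {c} (inj₁ trivial) = diagonal-generalizes⇒≡
    (proj₁ (trivial (inj₁ (diagonal-generalizes-loop v a))) (b ⟶ c))
  loop-≲⇒≡ v {a} (inj₂ (_ , maximal)) = diagonal-generalizes⇒≡ (proj₂ (shared (loop , loop)))
    where
    loop   = diagonal-generalizes-loop v a
    -- `↑∩` of a loop with itself is its whole `↑`, so the inclusion that maximality asks for is a
    -- projection.
    shared = proj₂ (maximal (a ⟶ a) (λ (g∈↑e , _) → g∈↑e , g∈↑e))

  -- No arrow shares more with `e` than `e` itself, so maximality is automatic; whether `e` has a
  -- nontrivial generalization decides the clause.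
  ≲-refl : ExcludedMiddle (o ⊔ x ⊔ ℓ) → ∀ e → Similar≲ X 𝔄 𝔄 e e
  ≲-refl em e with em {∃[ g ] g ∈ ↑∩ X 𝔄 𝔄 e e × ¬ (g ∈ Trivial X 𝔄 𝔄)}
  ... | yes nontrivial = inj₂ (nontrivial , λ _ e⊆ → e⊆ , λ (g∈↑e , _) → g∈↑e , g∈↑e)
  ... | no ¬nontrivial = inj₁ λ g∈ → ↑⊆Trivial ([ id , id ]′ g∈)
    where
    ↑⊆Trivial : ↑ X 𝔄 e ⊆ Trivial X 𝔄 𝔄
    ↑⊆Trivial g∈↑e = em⇒dne em λ ¬trivial → ¬nontrivial (_ , (g∈↑e , g∈↑e) , ¬trivial)

theorem3 : ∀ {o x ℓ : Level} →
    (em : ExcludedMiddle (o ⊔ x ⊔ ℓ)) →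
    (X : Set x) → X ↔ ℕ →
    (L : Language o) (𝔄 : Algebra L ℓ) →
    (a d : Carrier 𝔄) →
    Proportion X 𝔄 𝔄 a a a d ⇔ d ≡ a
theorem3 em X X↔ℕ L 𝔄 a d = mk⇔
  -- The variable numbered 0 serves as the x in x → x.
  (λ ((a⟶a≲a⟶d , _) , _) → sym (loop-≲⇒≡ 𝔄 (Inverse.from X↔ℕ 0) a⟶a≲a⟶d))
  (λ { refl → let a⟶a≲a⟶a = ≲-refl 𝔄 em (a ⟶ a)
              in (a⟶a≲a⟶a , a⟶a≲a⟶a) , (a⟶a≲a⟶a , a⟶a≲a⟶a) })
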